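{- Let $G$ be a graph, $x$ a vertex of $G$ with $\deg x=k\ge 1$, and let $A=\{a_1,\dots,a_k\}$ be the set of neighbours of $x$. Then $$\psi(G)=\frac{(-1)^{k+1}}{2}\,\psi(\overline{G}_x)+\frac{(-1)^k}{4}\,\psi(\overline{G}_x^{a_1})+\frac14\,\psi(G_x^{a_1}),$$ where $\overline{G}_x$ is obtained from $G$ by deleting $x$ and inverting all edges within $A$ (i.e. complementing the induced subgraph on $A$: two distinct vertices of $A$ are adjacent in $\overline G_x$ iff they are not adjacent in $G$); $\overline{G}_x^{a_1}$ is obtained from $\overline{G}_x$ by applying the 2T transform to all pairs $(a_1,a_i)$, $i=2,\dots,k$, and then deleting $a_1$; and $G_x^{a_1}$ is obtained from $G$ by deleting $x$, applying the 2T transform to all pairs $(a_1,a_i)$, $i=2,\dots,k$, and then deleting $a_1$.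
   Context: All graphs are finite and simple. A framed graph is a graph together with a function (framing) from its vertex set to $\mathbb{Z}/2\mathbb{Z}$. The adjacency matrix over $\mathbb{Z}/2\mathbb{Z}$ of a framed graph has the usual off-diagonal adjacency entries, and its diagonal entries are the framings of the corresponding vertices. $\eta$ denotes the corank (dimension of the kernel) of this matrix over $\mathbb{Z}/2\mathbb{Z}$; it is $0$ for the empty graph. For a (non-framed) graph $G$ with vertex set $V$, $$\psi(G)=2^{ -|V|}\sum_{V'\subseteq V}(-1)^{|V'|}\,3^{\eta(G_{V'})},$$ where $G_{V'}$ is the framed graph obtained from $G$ by assigning framing $1$ to the vertices in $V'$ and framing $0$ to the vertices in $V\setminus V'$. The 2T transform of a (non-framed) graph for an ordered pair $(a,b)$ of distinct vertices switches the adjacency of $b$ with every vertex $v\neq a,b$ that is adjacent to $a$ (so the set of neighbours of $b$ outside $\{a,b\}$ is replaced by its symmetric difference with the set of neighbours of $a$ outside $\{a,b\}$), leaving everything else, including the presence or absence of the edge $ab$, unchanged. -}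

module Defs where

open import Data.Bool.Base using (Bool; true; false; if_then_else_; not; _∧_; _∨_; _xor_)
open import Data.Bool.Properties using (xor-∧-commutativeRing; xor-comm; xor-same; ∨-comm; ∧-comm; ∧-assoc; ∧-zeroʳ)
open import Data.Fin.Base using (Fin; zero; suc; punchIn; punchOut)
open import Data.Fin.Properties using (_≟_)
open import Data.Fin.Subset using (Subset; inside; outside; ∣_∣)
open import Data.Integer.Base as ℤ using (ℤ; +_; -1ℤ)
open import Data.Nat.Base as ℕ using (ℕ; zero; suc)
open import Data.Nat.Properties using (m^n≢0)
open import Data.Product.Base using (∃; _,_; proj₁)
open import Data.Rational.Base as ℚ using (ℚ)
open import Data.Vec.Base as Vec using (lookup; tabulate)
open import Data.Vec.Functional using (Vector; head; tail; foldl; _∷_)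
open import Function.Base using (_∘_; const)
open import Function.Definitions using (Injective)
open import Relation.Binary.PropositionalEquality
  using (_≡_; _≢_; refl; sym; trans; cong; cong₂; module ≡-Reasoning)
open import Relation.Nullary.Decidable.Core using (does)
open import Relation.Nullary.Negation.Core using (contradiction)

open import Algebra.Bundles using (CommutativeRing)
import Algebra.Properties.Semiring.Sum as Sum
open Sum (CommutativeRing.semiring xor-∧-commutativeRing)
  using (sum; sum-cong-≗; sum-replicate-zero; ∑-comm; *-distribˡ-sum)

-- ℤ/2ℤ is the ring (Bool, _xor_, _∧_).
𝔽₂ : Set
𝔽₂ = Bool

Matrix : ℕ → ℕ → Set
Matrix m n = Fin m → Fin n → 𝔽₂

infix 8 _·_

_·_ : ∀ {n} → Vector 𝔽₂ n → Vector 𝔽₂ n → 𝔽₂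
u · v = sum λ i → u i ∧ v i

combination : ∀ {n d} → Vector 𝔽₂ d → Vector (Vector 𝔽₂ n) d → Vector 𝔽₂ n
combination c b i = c · λ j → b j i

Kernel : ∀ {m n} → Matrix m n → Vector 𝔽₂ n → Set
Kernel M v = ∀ i → M i · v ≡ false

record IsBasis {n d} (W : Vector 𝔽₂ n → Set) (b : Vector (Vector 𝔽₂ n) d) : Set where
  field
    member      : ∀ j → W (b j)
    independent : ∀ c → (∀ i → combination c b i ≡ false) → ∀ j → c j ≡ false
    spanning    : ∀ v → W v → ∃ λ c → ∀ i → combination c b i ≡ v i

does-≟-refl : ∀ {n} (i : Fin n) → does (i ≟ i) ≡ true
does-≟-refl zero    = refl
does-≟-refl (suc i) = does-≟-refl i

does-≟-sym : ∀ {n} (i j : Fin n) → does (i ≟ j) ≡ does (j ≟ i)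
does-≟-sym zero    zero    = refl
does-≟-sym zero    (suc j) = refl
does-≟-sym (suc i) zero    = refl
does-≟-sym (suc i) (suc j) = does-≟-sym i j

·-congʳ : ∀ {n} (u : Vector 𝔽₂ n) {v w} → (∀ i → v i ≡ w i) → u · v ≡ u · w
·-congʳ u eq = sum-cong-≗ λ i → cong (u i ∧_) (eq i)

·-congˡ : ∀ {n} {u v : Vector 𝔽₂ n} w → (∀ i → u i ≡ v i) → u · w ≡ v · w
·-congˡ w eq = sum-cong-≗ λ i → cong (_∧ w i) (eq i)

·-comm : ∀ {n} (u v : Vector 𝔽₂ n) → u · v ≡ v · u
·-comm u v = sum-cong-≗ λ i → ∧-comm (u i) (v i)

·-zeroʳ : ∀ {n} (u : Vector 𝔽₂ n) → u · const false ≡ false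
·-zeroʳ {n} u = trans (sum-cong-≗ λ i → ∧-zeroʳ (u i)) (sum-replicate-zero n)

·-combination : ∀ {n d} (r : Vector 𝔽₂ n) c (b : Vector (Vector 𝔽₂ n) d) →
                r · combination c b ≡ c · λ j → r · b j
·-combination {n} {d} r c b = begin
  sum (λ i → r i ∧ sum λ j → c j ∧ b j i)
    ≡⟨ sum-cong-≗ (λ i → *-distribˡ-sum (r i) λ j → c j ∧ b j i) ⟩
  sum (λ i → sum λ j → r i ∧ (c j ∧ b j i))
    ≡⟨ ∑-comm (λ i j → r i ∧ (c j ∧ b j i)) ⟩
  sum (λ j → sum λ i → r i ∧ (c j ∧ b j i))
    ≡⟨ sum-cong-≗ (λ j → sum-cong-≗ λ i → swap (r i) (c j) (b j i)) ⟩
  sum (λ j → sum λ i → c j ∧ (r i ∧ b j i))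
    ≡⟨ sum-cong-≗ (λ j → *-distribˡ-sum (c j) λ i → r i ∧ b j i) ⟨
  sum (λ j → c j ∧ sum λ i → r i ∧ b j i) ∎
  where
  open ≡-Reasoning
  swap : ∀ x y z → x ∧ (y ∧ z) ≡ y ∧ (x ∧ z)
  swap x y z = trans (sym (∧-assoc x y z)) (trans (cong (_∧ z) (∧-comm x y)) (∧-assoc y x z))

combination-assoc : ∀ {n d e} c (B : Vector (Vector 𝔽₂ d) e) (b : Vector (Vector 𝔽₂ n) d) i →
                    combination c (λ l → combination (B l) b) i ≡ combination (combination c B) b i
combination-assoc c B b i = begin
  c · (λ l → B l · λ j → b j i)     ≡⟨ ·-congʳ c (λ l → ·-comm (B l) (λ j → b j i)) ⟩
  c · (λ l → (λ j → b j i) · B l)   ≡⟨ ·-combination (λ j → b j i) c B ⟨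
  (λ j → b j i) · combination c B   ≡⟨ ·-comm (λ j → b j i) (combination c B) ⟩
  combination c B · (λ j → b j i)   ∎
  where open ≡-Reasoning

unit : ∀ {n} → Fin n → Vector 𝔽₂ n
unit j i = does (i ≟ j)

combination-unit : ∀ {n} (c : Vector 𝔽₂ n) i → combination c unit i ≡ c i
combination-unit c zero = begin
  (c zero ∧ true) xor (tail c · const false)  ≡⟨ cong₂ _xor_ (∧-comm (c zero) true) (·-zeroʳ (tail c)) ⟩
  c zero xor false                            ≡⟨ xor-comm (c zero) false ⟩
  c zero                                      ∎
  where open ≡-Reasoning
combination-unit c (suc i) =
  trans (cong (_xor combination (tail c) unit i) (∧-zeroʳ (c zero))) (combination-unit (tail c) i)

pivotBasis : ∀ {d} → Vector 𝔽₂ (suc d) → Vector (Vector 𝔽₂ (suc d)) d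
pivotBasis e j = e (suc j) ∷ unit j

pivot-isBasis : ∀ {d} (e : Vector 𝔽₂ (suc d)) → e zero ≡ true →
                IsBasis (λ c → c · e ≡ false) (pivotBasis e)
pivot-isBasis e e₀ = record
  { member      = λ j → trans (cong₂ _xor_ (*-e₀ (e (suc j))) (unit-· j)) (xor-same (e (suc j)))
  ; independent = λ c eq j → trans (sym (combination-unit c j)) (eq (suc j))
  ; spanning    = λ v v∈ → tail v , λ
    { zero    → sym (trans (sym (*-e₀ (v zero))) (xor≡false _ (tail v · tail e) v∈))
    ; (suc i) → combination-unit (tail v) i
    }
  }
  where
  *-e₀ : ∀ x → x ∧ e zero ≡ x
  *-e₀ x = trans (cong (x ∧_) e₀) (∧-comm x true)
  unit-· : ∀ j → unit j · tail e ≡ e (suc j)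
  unit-· j = trans (·-comm (unit j) (tail e))
               (trans (·-congʳ (tail e) (λ i → does-≟-sym i j)) (combination-unit (tail e) j))
  xor≡false : ∀ x y → x xor y ≡ false → x ≡ y
  xor≡false false y    eq = sym eq
  xor≡false true  true eq = refl

extend : ∀ {d d′} → Vector (Vector 𝔽₂ d) d′ → Vector (Vector 𝔽₂ (suc d)) (suc d′)
extend b = unit zero ∷ λ j → false ∷ b j

combination-extend₀ : ∀ {d d′} c (b : Vector (Vector 𝔽₂ d) d′) →
                      combination c (extend b) zero ≡ c zero
combination-extend₀ c b =
  trans (cong₂ _xor_ (∧-comm (c zero) true) (·-zeroʳ (tail c))) (xor-comm (c zero) false)

combination-extend₊ : ∀ {d d′} c (b : Vector (Vector 𝔽₂ d) d′) i →
                      combination c (extend b) (suc i) ≡ combination (tail c) b i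
combination-extend₊ c b i = cong (_xor combination (tail c) b i) (∧-zeroʳ (c zero))

extend-isBasis : ∀ {d d′} (e : Vector 𝔽₂ (suc d)) {b : Vector (Vector 𝔽₂ d) d′} → e zero ≡ false →
                 IsBasis (λ c → c · tail e ≡ false) b → IsBasis (λ c → c · e ≡ false) (extend b)
extend-isBasis e {b} e₀ isB = record
  { member      = λ
    { zero    → trans (cong₂ _xor_ e₀ (·-comm (const false) (tail e))) (·-zeroʳ (tail e))
    ; (suc j) → member j
    }
  ; independent = λ c eq → λ
    { zero    → trans (sym (combination-extend₀ c b)) (eq zero)
    ; (suc j) → independent (tail c) (λ i → trans (sym (combination-extend₊ c b i)) (eq (suc i))) j
    }
  ; spanning    = λ v v∈ →
      let c , eq = spanning (tail v) (trans (sym (cong (_xor tail v · tail e) (*-e₀ (v zero)))) v∈) in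
      v zero ∷ c , λ
    { zero    → combination-extend₀ (v zero ∷ c) b
    ; (suc i) → trans (combination-extend₊ (v zero ∷ c) b i) (eq i)
    }
  }
  where
  open IsBasis isB
  *-e₀ : ∀ x → x ∧ e zero ≡ false
  *-e₀ x = trans (cong (x ∧_) e₀) (∧-zeroʳ x)

functionalBasis : ∀ {d} (e : Vector 𝔽₂ d) →
                  ∃ λ d′ → ∃ λ (b : Vector (Vector 𝔽₂ d) d′) → IsBasis (λ c → c · e ≡ false) b
functionalBasis {zero} e = 0 , (λ ()) , record
  { member      = λ ()
  ; independent = λ _ _ ()
  ; spanning    = λ _ _ → (λ ()) , λ ()
  }
functionalBasis {suc d} e = go (e zero) refl
  where
  go : ∀ x → e zero ≡ x →
       ∃ λ d′ → ∃ λ (b : Vector (Vector 𝔽₂ (suc d)) d′) → IsBasis (λ c → c · e ≡ false) b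
  go true  e₀ = d , pivotBasis e , pivot-isBasis e e₀
  go false e₀ = let d′ , b , isB = functionalBasis (tail e) in
                suc d′ , extend b , extend-isBasis e e₀ isB

kernelBasis : ∀ {m n} (M : Matrix m n) → ∃ λ d → ∃ λ (b : Vector (Vector 𝔽₂ n) d) → IsBasis (Kernel M) b
kernelBasis {zero} {n} M = n , unit , record
  { member      = λ _ ()
  ; independent = λ c eq j → trans (sym (combination-unit c j)) (eq j)
  ; spanning    = λ v _ → v , combination-unit v
  }
kernelBasis {suc m} {n} M =
  let d , b , isb = kernelBasis (tail M)
      e , B , isB = functionalBasis (λ j → head M · b j)
      module b = IsBasis isb
      module B = IsBasis isB
  in e , (λ l → combination (B l) b) , record
  { member      = λ l → λ
    { zero    → trans (·-combination (head M) (B l) b) (B.member l)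
    ; (suc i) → trans (·-combination (M (suc i)) (B l) b)
                  (trans (·-congʳ (B l) λ j → b.member j i) (·-zeroʳ (B l)))
    }
  ; independent = λ c eq → B.independent c
      (b.independent (combination c B) λ i → trans (sym (combination-assoc c B b i)) (eq i))
  ; spanning    = λ v v∈ →
      let c , eqc = b.spanning v (v∈ ∘ suc)
          f , eqf = B.spanning c (trans (sym (·-combination (head M) c b))
                                    (trans (·-congʳ (head M) eqc) (v∈ zero)))
      in f , λ i → trans (combination-assoc f B b i)
                     (trans (·-congˡ (λ j → b j i) eqf) (eqc i))
  }

-- The length of the basis constructed above, that is, dim (Kernel M).
corank : ∀ {m n} → Matrix m n → ℕ
corank M = proj₁ (kernelBasis M)

record Graph (n : ℕ) : Set where
  field
    adj      : Fin n → Fin n → Bool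
    adj-sym  : ∀ u v → adj u v ≡ adj v u
    loopless : ∀ v → adj v v ≡ false

open Graph public

Adj : ∀ {n} → Graph n → Fin n → Fin n → Set
Adj G u v = adj G u v ≡ true

Adj⇒≢ : ∀ {n} (G : Graph n) {u v} → Adj G u v → u ≢ v
Adj⇒≢ G {u} uv refl = contradiction (trans (sym (loopless G u)) uv) λ ()

neighbourhood : ∀ {n} → Graph n → Fin n → Subset n
neighbourhood G x = tabulate (adj G x)

degree : ∀ {n} → Graph n → Fin n → ℕ
degree G x = ∣ neighbourhood G x ∣

record FramedGraph (n : ℕ) : Set where
  constructor _⟨_⟩
  field
    graph   : Graph n
    framing : Fin n → 𝔽₂

adjacencyMatrix : ∀ {n} → FramedGraph n → Matrix n n
adjacencyMatrix (G ⟨ f ⟩) u v = if does (u ≟ v) then f u else adj G u v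

η : ∀ {n} → FramedGraph n → ℕ
η F = corank (adjacencyMatrix F)

sumSubsets : ∀ {n} → (Subset n → ℤ) → ℤ
sumSubsets {zero}  f = f Vec.[]
sumSubsets {suc n} f = sumSubsets (λ S → f (outside Vec.∷ S)) ℤ.+ sumSubsets (λ S → f (inside Vec.∷ S))

-- Membership in a Subset is a Bool, with inside = true = 1, so looking up
-- V′ is the framing that is 1 exactly on V′.
ψ : ∀ {n} → Graph n → ℚ
ψ {n} G = sumSubsets (λ V′ → -1ℤ ℤ.^ ∣ V′ ∣ ℤ.* + (3 ℕ.^ η (G ⟨ lookup V′ ⟩))) ℚ./ (2 ℕ.^ n)
  where instance _ = m^n≢0 2 n

-- The vertices of delete G x are relabelled along punchIn x : Fin n → Fin (suc n).
delete : ∀ {n} → Graph (suc n) → Fin (suc n) → Graph n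
delete G x = record
  { adj      = λ u v → adj G (punchIn x u) (punchIn x v)
  ; adj-sym  = λ u v → adj-sym G (punchIn x u) (punchIn x v)
  ; loopless = λ v → loopless G (punchIn x v)
  }

invertWithin : ∀ {n} → Graph n → Subset n → Graph n
invertWithin G S = record
  { adj      = λ u v → if both u v then not (adj G u v) else adj G u v
  ; adj-sym  = λ u v → cong₂ (λ b e → if b then not e else e) (both-sym u v) (adj-sym G u v)
  ; loopless = λ v → trans (cong (λ b → if b then not (adj G v v) else adj G v v) (both-irrefl v))
                       (loopless G v)
  }
  where
  both : ∀ u v → Bool
  both u v = not (does (u ≟ v)) ∧ (lookup S u ∧ lookup S v)
  both-sym : ∀ u v → both u v ≡ both v u
  both-sym u v = cong₂ (λ d e → not d ∧ e) (does-≟-sym u v) (∧-comm (lookup S u) (lookup S v))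
  both-irrefl : ∀ v → both v v ≡ false
  both-irrefl v = cong (λ d → not d ∧ (lookup S v ∧ lookup S v)) (does-≟-refl v)

-- switched u v holds when uv is a pair {b , w} with w ≠ a , b and w adjacent to a.
twoT : ∀ {n} → Graph n → Fin n → Fin n → Graph n
twoT G a b = record
  { adj      = λ u v → adj G u v xor switched u v
  ; adj-sym  = λ u v → cong₂ _xor_ (adj-sym G u v) (∨-comm (from u v) (from v u))
  ; loopless = λ v → cong₂ _xor_ (loopless G v) (cong₂ _∨_ (from-irrefl v) (from-irrefl v))
  }
  where
  from : ∀ u w → Bool
  from u w = does (u ≟ b) ∧ (not (does (w ≟ a)) ∧ (not (does (w ≟ b)) ∧ adj G a w))
  switched : ∀ u v → Bool
  switched u v = from u v ∨ from v u
  from-irrefl : ∀ v → from v v ≡ false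
  from-irrefl v with does (v ≟ b)
  ... | false = refl
  ... | true  = ∧-zeroʳ (not (does (v ≟ a)))

-- Ḡₓ ↦ Ḡₓ^a₁ : with a = (a₁ , … , aₖ), transform along (a₁ , a₂) , … , (a₁ , aₖ)
-- in turn, then delete a₁.
spreadAndDelete : ∀ {n k} → Graph (suc n) → Vector (Fin (suc n)) (suc k) → Graph n
spreadAndDelete G a = delete (foldl (λ H b → twoT H (head a) b) G (tail a)) (head a)

record EnumeratesNeighbours {n k} (G : Graph n) (x : Fin n) (a : Vector (Fin n) k) : Set where
  field
    injective : Injective _≡_ _≡_ a
    adjacent  : ∀ i → Adj G x (a i)
    complete  : ∀ v → Adj G x v → ∃ λ i → a i ≡ v

-- The aᵢ as vertices of delete G x.
neighboursAfterDelete : ∀ {n k} (G : Graph (suc n)) (x : Fin (suc n)) (a : Vector (Fin (suc n)) k) →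
                        EnumeratesNeighbours G x a → Vector (Fin n) k
neighboursAfterDelete G x a enum i = punchOut (Adj⇒≢ G (adjacent i))
  where open EnumeratesNeighbours enum

-- Ḡₓ
invertedDelete : ∀ {n} → Graph (suc n) → Fin (suc n) → Graph n
invertedDelete G x = delete (invertWithin G (neighbourhood G x)) x

{-# OPTIONS --safe #-}
module Submission where

-- Split ψ(G) according to the framing of x, and eliminate x from the adjacency matrix by a Schur
-- complement, which does not change the corank. If x has framing 1, then the entry at (x , x) is a
-- pivot; eliminating it toggles the edges and the framings within A, so this half is the sum for Ḡₓ up
-- to the sign (-1)ᵏ⁺¹. If x has framing 0, then the entries at (x , a₁) and (a₁ , x) are pivots;
-- eliminating both adds α(u) ν(v) + α(v) ν(u) + f(a₁) α(u) α(v) to the entry at (u , v), where α and ν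
-- are the rows of x and a₁. According to the framing f(a₁) of a₁ this is Gₓ^a₁, or Ḡₓ^a₁ with the
-- framings within A toggled.

open import Defs
open import Algebra.Bundles using (CommutativeRing)
open import Data.Bool.Base using (Bool; true; false; not; _∧_; _xor_; if_then_else_)
open import Data.Bool.Properties
  using ( xor-∧-commutativeRing; xor-same; xor-comm; xor-identityʳ
        ; ∧-distribʳ-xor; ∧-assoc; ∧-idem; ∧-zeroʳ; ∨-identityʳ)
open import Data.Bool.Solver using (module xor-∧-Solver)
open import Data.Fin.Base using (Fin; zero; suc; punchIn; punchOut; combine; funToFin; finToFun)
open import Data.Fin.Properties
  using ( _≟_; suc-injective; 2↔Bool; finToFun-funToFin; funToFin-finToFin; injective⇒≤
        ; punchIn-injective; punchInᵢ≢i; punchIn-punchOut)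
open import Data.Fin.Subset using (Subset; ∣_∣)
open import Data.Integer.Base as ℤ using (ℤ; +_; -1ℤ; _^_)
import Data.Integer.Properties as ℤ
open import Data.Integer.Tactic.RingSolver using (solve-∀)
open import Data.Nat.Base as ℕ using (ℕ; suc; zero)
import Data.Nat.Properties as ℕ
open import Data.Product.Base using (∃; _,_; proj₁; proj₂)
open import Data.Rational.Base as ℚ using (_/_; _+_; _*_)
import Data.Rational.Properties as ℚ
open import Data.Rational.Unnormalised.Base as ℚᵘ using (mkℚᵘ; *≡*)
import Data.Rational.Unnormalised.Properties as ℚᵘ
open import Data.Vec.Base using ([]; _∷_; lookup; tabulate; insertAt; zipWith)
open import Data.Vec.Functional as Vector using (Vector; head; tail; foldl)
import Data.Vec.Functional.Properties as Vector
open import Data.Vec.Properties using (insertAt-lookup; insertAt-punchIn; lookup∘tabulate; lookup-zipWith)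
open import Function.Base using (_∘_)
open import Function.Bundles using (Inverse)
open import Function.Definitions using (Injective)
open import Relation.Binary.PropositionalEquality
  using (_≡_; _≢_; _≗_; refl; sym; trans; cong; cong₂; module ≡-Reasoning)
open import Relation.Nullary.Decidable using (yes; no; does; dec-false)
open import Relation.Nullary.Negation.Core using (contradiction)

open import Algebra.Properties.Semiring.Sum (CommutativeRing.semiring xor-∧-commutativeRing)
  using (sum; sum-cong-≗; sum-remove; sum-replicate-zero; ∑-distrib-+; *-distribˡ-sum)

open ≡-Reasoning

-- Coranks

xor≡false⇒≡ : ∀ {x y} → x xor y ≡ false → x ≡ y
xor≡false⇒≡ {false} {false} _ = refl
xor≡false⇒≡ {true}  {true}  _ = refl

·-distribʳ-xor : ∀ {n} (w u v : Vector 𝔽₂ n) → (λ i → u i xor v i) · w ≡ u · w xor v · w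
·-distribʳ-xor w u v = trans (sum-cong-≗ λ i → ∧-distribʳ-xor (w i) (u i) (v i))
                             (∑-distrib-+ (λ i → u i ∧ w i) (λ i → v i ∧ w i))

·-scaleˡ : ∀ {n} x (u v : Vector 𝔽₂ n) → (λ i → x ∧ u i) · v ≡ x ∧ (u · v)
·-scaleˡ x u v = trans (sum-cong-≗ λ i → ∧-assoc x (u i) (v i)) (sym (*-distribˡ-sum x (λ i → u i ∧ v i)))

·-remove : ∀ {n} j (u v : Vector 𝔽₂ (suc n)) → u · v ≡ u j ∧ v j xor (u ∘ punchIn j) · (v ∘ punchIn j)
·-remove j u v = sum-remove {i = j} (λ i → u i ∧ v i)

combination∈Kernel : ∀ {m n d} (M : Matrix m n) {b : Vector (Vector 𝔽₂ n) d} →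
                     (∀ j → Kernel M (b j)) → ∀ c → Kernel M (combination c b)
combination∈Kernel M {b} b∈ c i =
  trans (·-combination (M i) c b) (trans (·-congʳ c λ j → b∈ j i) (·-zeroʳ c))

-- Modulo 2 the difference of `c` and `e` is their `xor`, and independence applies to it.
combination-injective : ∀ {n d} {W : Vector 𝔽₂ n → Set} {b : Vector (Vector 𝔽₂ n) d} → IsBasis W b →
                        ∀ c e → combination c b ≗ combination e b → c ≗ e
combination-injective {b = b} isB c e eq j =
  xor≡false⇒≡ (IsBasis.independent isB (λ i → c i xor e i) difference≡0 j)
  where
  difference≡0 : ∀ i → combination (λ l → c l xor e l) b i ≡ false
  difference≡0 i = begin
    combination (λ l → c l xor e l) b i          ≡⟨ ·-distribʳ-xor (λ l → b l i) c e ⟩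
    combination c b i xor combination e b i      ≡⟨ cong (_xor combination e b i) (eq i) ⟩
    combination e b i xor combination e b i      ≡⟨ xor-same (combination e b i) ⟩
    false                                        ∎

2^-cancel-≤ : ∀ {d e} → 2 ℕ.^ d ℕ.≤ 2 ℕ.^ e → d ℕ.≤ e
2^-cancel-≤ 2^d≤2^e = ℕ.≮⇒≥ λ e<d → ℕ.<⇒≱ (ℕ.^-monoʳ-< 2 ℕ.≤-refl e<d) 2^d≤2^e

funToFin-cong : ∀ {m n} {f g : Fin m → Fin n} → f ≗ g → funToFin f ≡ funToFin g
funToFin-cong {zero}  eq = refl
funToFin-cong {suc m} eq = cong₂ combine (eq zero) (funToFin-cong (eq ∘ suc))

-- A d-dimensional space has 2 ^ d vectors, so the injection need not be linear.
corank-≤ : ∀ {m n m′ n′} (M : Matrix m n) (N : Matrix m′ n′) (φ : Vector 𝔽₂ n → Vector 𝔽₂ n′) →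
           (∀ {v} → Kernel M v → Kernel N (φ v)) →
           (∀ {v w} → Kernel M v → Kernel M w → φ v ≗ φ w → v ≗ w) →
           corank M ℕ.≤ corank N
corank-≤ M N φ φ∈ φ-inj = 2^-cancel-≤ (injective⇒≤ {f = code} code-injective)
  where
  d = corank M
  e = corank N
  b = proj₁ (proj₂ (kernelBasis M))
  b′ = proj₁ (proj₂ (kernelBasis N))
  isB = proj₂ (proj₂ (kernelBasis M))
  isB′ = proj₂ (proj₂ (kernelBasis N))
  module 2↔ = Inverse 2↔Bool

  bits : Fin (2 ℕ.^ d) → Vector 𝔽₂ d
  bits k = 2↔.to ∘ finToFun k

  vec : Fin (2 ℕ.^ d) → Vector 𝔽₂ _
  vec k = combination (bits k) b

  vec∈ : ∀ k → Kernel M (vec k)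
  vec∈ k = combination∈Kernel M (IsBasis.member isB) (bits k)

  coordinates : ∀ k → ∃ λ c → combination c b′ ≗ φ (vec k)
  coordinates k = IsBasis.spanning isB′ (φ (vec k)) (φ∈ (vec∈ k))

  -- The binary digits of `k` are read as coefficients on `b`. The coordinates on `b′` of the image
  -- under `φ` are packed into a number again, so that the pigeonhole principle compares `2 ^ d`
  -- with `2 ^ e`.
  code : Fin (2 ℕ.^ d) → Fin (2 ℕ.^ e)
  code k = funToFin (2↔.from ∘ proj₁ (coordinates k))

  finToFun-code : ∀ k → finToFun (code k) ≗ 2↔.from ∘ proj₁ (coordinates k)
  finToFun-code k = finToFun-funToFin (2↔.from ∘ proj₁ (coordinates k))

  code-injective : ∀ {k l} → code k ≡ code l → k ≡ l
  code-injective {k} {l} eq = begin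
    k                          ≡⟨ funToFin-finToFin {d} k ⟨
    funToFin {d} (finToFun k)  ≡⟨ funToFin-cong {d} (λ i → begin
      finToFun k i               ≡⟨ 2↔.strictlyInverseʳ _ ⟨
      2↔.from (bits k i)         ≡⟨ cong 2↔.from (bits≗ i) ⟩
      2↔.from (bits l i)         ≡⟨ 2↔.strictlyInverseʳ _ ⟩
      finToFun l i               ∎) ⟩
    funToFin {d} (finToFun l)  ≡⟨ funToFin-finToFin {d} l ⟩
    l                          ∎
    where
    coordinates≗ : proj₁ (coordinates k) ≗ proj₁ (coordinates l)
    coordinates≗ i = begin
      proj₁ (coordinates k) i                      ≡⟨ 2↔.strictlyInverseˡ _ ⟨
      2↔.to (2↔.from (proj₁ (coordinates k) i))    ≡⟨ cong 2↔.to (finToFun-code k i) ⟨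
      2↔.to (finToFun (code k) i)                  ≡⟨ cong (λ c → 2↔.to (finToFun c i)) eq ⟩
      2↔.to (finToFun (code l) i)                  ≡⟨ cong 2↔.to (finToFun-code l i) ⟩
      2↔.to (2↔.from (proj₁ (coordinates l) i))    ≡⟨ 2↔.strictlyInverseˡ _ ⟩
      proj₁ (coordinates l) i                      ∎

    bits≗ : bits k ≗ bits l
    bits≗ = combination-injective isB (bits k) (bits l) (φ-inj (vec∈ k) (vec∈ l) λ i → begin
      φ (vec k) i                                ≡⟨ proj₂ (coordinates k) i ⟨
      combination (proj₁ (coordinates k)) b′ i   ≡⟨ ·-congˡ (λ j → b′ j i) coordinates≗ ⟩
      combination (proj₁ (coordinates l)) b′ i   ≡⟨ proj₂ (coordinates l) i ⟩
      φ (vec l) i                                ∎)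

-- `corank` is the length of one computed basis, and pointwise equality does not by itself equate
-- the matrices. The two kernels have the same vectors, however, so the identity map gives both
-- inequalities.
corank-cong : ∀ {m n} {M N : Matrix m n} → (∀ i → M i ≗ N i) → corank M ≡ corank N
corank-cong {M = M} {N} M≗N = ℕ.≤-antisym
  (corank-≤ M N (λ v → v) (λ {v} v∈ i → trans (sym (·-congˡ v (M≗N i))) (v∈ i)) λ _ _ eq → eq)
  (corank-≤ N M (λ v → v) (λ {v} v∈ i → trans (·-congˡ v (M≗N i)) (v∈ i)) λ _ _ eq → eq)

-- Schur complements

schur : ∀ {m n} → Matrix (suc m) (suc n) → Fin (suc m) → Fin (suc n) → Matrix m n
schur M i j u v = M (punchIn i u) (punchIn j v) xor (M (punchIn i u) j ∧ M i (punchIn j v))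

module _ {m n} (M : Matrix (suc m) (suc n)) i j (pivot : M i j ≡ true) where

  private
    row : Vector 𝔽₂ n
    row = M i ∘ punchIn j

    pivotRow : ∀ v → M i · v ≡ v j xor row · (v ∘ punchIn j)
    pivotRow v = trans (·-remove j (M i) v) (cong (λ p → (p ∧ v j) xor row · (v ∘ punchIn j)) pivot)

    -- Under the pivot equation the correction term of the Schur complement contributes `r j ∧ v j`,
    -- which is exactly the summand lost by dropping column `j`.
    schur-· : ∀ v → v j ≡ row · (v ∘ punchIn j) → ∀ u →
              schur M i j u · (v ∘ punchIn j) ≡ M (punchIn i u) · v
    schur-· v vⱼ u = begin
      schur M i j u · v′                       ≡⟨ ·-distribʳ-xor v′ r′ (λ w → r j ∧ row w) ⟩
      r′ · v′ xor (λ w → r j ∧ row w) · v′     ≡⟨ cong (r′ · v′ xor_) (·-scaleˡ (r j) row v′) ⟩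
      r′ · v′ xor (r j ∧ (row · v′))           ≡⟨ cong (λ y → r′ · v′ xor (r j ∧ y)) vⱼ ⟨
      r′ · v′ xor (r j ∧ v j)                  ≡⟨ xor-comm (r′ · v′) (r j ∧ v j) ⟩
      (r j ∧ v j) xor r′ · v′                  ≡⟨ ·-remove j r v ⟨
      r · v                                    ∎
      where
      r  = M (punchIn i u)
      r′ = r ∘ punchIn j
      v′ = v ∘ punchIn j

    solved : ∀ v → Kernel M v → v j ≡ row · (v ∘ punchIn j)
    solved v v∈ = xor≡false⇒≡ (trans (sym (pivotRow v)) (v∈ i))

    lift : Vector 𝔽₂ n → Vector 𝔽₂ (suc n)
    lift w = Vector.insertAt w j (row · w)

    lift-punchIn : ∀ w → lift w ∘ punchIn j ≗ w
    lift-punchIn w = Vector.insertAt-punchIn w j (row · w)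

    lift-pivot : ∀ w → lift w j ≡ row · (lift w ∘ punchIn j)
    lift-pivot w = trans (Vector.insertAt-lookup w j (row · w)) (sym (·-congʳ row (lift-punchIn w)))

    lift∈ : ∀ {w} → Kernel (schur M i j) w → Kernel M (lift w)
    lift∈ {w} w∈ r with i ≟ r
    ... | yes refl = begin
      M i · lift w                            ≡⟨ pivotRow (lift w) ⟩
      lift w j xor row · (lift w ∘ punchIn j) ≡⟨ cong (_xor row · (lift w ∘ punchIn j)) (lift-pivot w) ⟩
      row · (lift w ∘ punchIn j) xor row · (lift w ∘ punchIn j)
                                              ≡⟨ xor-same (row · (lift w ∘ punchIn j)) ⟩
      false                                   ∎
    ... | no  i≢r  = begin
      M r · lift w                                       ≡⟨ cong (λ s → M s · lift w) (punchIn-punchOut i≢r) ⟨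
      M (punchIn i (punchOut i≢r)) · lift w              ≡⟨ schur-· (lift w) (lift-pivot w) (punchOut i≢r) ⟨
      schur M i j (punchOut i≢r) · (lift w ∘ punchIn j)  ≡⟨ ·-congʳ (schur M i j (punchOut i≢r)) (lift-punchIn w) ⟩
      schur M i j (punchOut i≢r) · w                     ≡⟨ w∈ (punchOut i≢r) ⟩
      false                                              ∎

  -- The pivot is 1, so the equation of row `i` determines coordinate `j` from the others. Dropping
  -- that coordinate and restoring it by `lift` are thus injective maps between the two kernels.
  -- Over the field with two elements the correction term needs neither a sign nor an inverse of the
  -- pivot.
  corank-schur : corank M ≡ corank (schur M i j)
  corank-schur = ℕ.≤-antisym
    (corank-≤ M (schur M i j) (_∘ punchIn j)
      (λ {v} v∈ u → trans (schur-· v (solved v v∈) u) (v∈ (punchIn i u)))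
      restriction-injective)
    (corank-≤ (schur M i j) M lift lift∈ λ {v} {w} _ _ eq l →
      trans (sym (lift-punchIn v l)) (trans (eq (punchIn j l)) (lift-punchIn w l)))
    where
    restriction-injective : ∀ {v w} → Kernel M v → Kernel M w →
                            v ∘ punchIn j ≗ w ∘ punchIn j → v ≗ w
    restriction-injective {v} {w} v∈ w∈ eq l with j ≟ l
    ... | yes refl = trans (solved v v∈) (trans (·-congʳ row eq) (sym (solved w w∈)))
    ... | no  j≢l  = begin
      v l                          ≡⟨ cong v (punchIn-punchOut j≢l) ⟨
      v (punchIn j (punchOut j≢l)) ≡⟨ eq (punchOut j≢l) ⟩
      w (punchIn j (punchOut j≢l)) ≡⟨ cong w (punchIn-punchOut j≢l) ⟩
      w l                          ∎

-- Signed sums over subsets, and fractions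

sumSubsets-cong : ∀ {n} {f g : Subset n → ℤ} → f ≗ g → sumSubsets f ≡ sumSubsets g
sumSubsets-cong {zero}  eq = eq []
sumSubsets-cong {suc n} eq =
  cong₂ ℤ._+_ (sumSubsets-cong (eq ∘ (false ∷_))) (sumSubsets-cong (eq ∘ (true ∷_)))

*-distribˡ-sumSubsets : ∀ {n} c (f : Subset n → ℤ) →
                        sumSubsets (λ S → c ℤ.* f S) ≡ c ℤ.* sumSubsets f
*-distribˡ-sumSubsets {zero}  c f = refl
*-distribˡ-sumSubsets {suc n} c f =
  trans (cong₂ ℤ._+_ (*-distribˡ-sumSubsets c (f ∘ (false ∷_))) (*-distribˡ-sumSubsets c (f ∘ (true ∷_))))
        (sym (ℤ.*-distribˡ-+ c (sumSubsets (f ∘ (false ∷_))) (sumSubsets (f ∘ (true ∷_)))))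

signedSum : ∀ {n} → (Subset n → ℤ) → ℤ
signedSum h = sumSubsets λ S → -1ℤ ^ ∣ S ∣ ℤ.* h S

signedSum-cong : ∀ {n} {f g : Subset n → ℤ} → f ≗ g → signedSum f ≡ signedSum g
signedSum-cong eq = sumSubsets-cong λ S → cong (-1ℤ ^ ∣ S ∣ ℤ.*_) (eq S)

signedSum-∷ : ∀ {n} (h : Subset (suc n) → ℤ) →
              signedSum h ≡ signedSum (h ∘ (false ∷_)) ℤ.+ -1ℤ ℤ.* signedSum (h ∘ (true ∷_))
signedSum-∷ h = cong (ℤ._+_ (signedSum (h ∘ (false ∷_)))) (trans
  (sumSubsets-cong λ S → ℤ.*-assoc -1ℤ (-1ℤ ^ ∣ S ∣) (h (true ∷ S)))
  (*-distribˡ-sumSubsets -1ℤ λ S → -1ℤ ^ ∣ S ∣ ℤ.* h (true ∷ S)))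

-- `sumSubsets` splits at the first coordinate only. For a later `x`, the four sums given by the
-- values at the first coordinate and at `x` are regrouped.
signedSum-insertAt : ∀ {n} (h : Subset (suc n) → ℤ) x →
                     signedSum h ≡ signedSum (λ S → h (insertAt S x false)) ℤ.+
                                   -1ℤ ℤ.* signedSum (λ S → h (insertAt S x true))
signedSum-insertAt         h zero    = signedSum-∷ h
signedSum-insertAt {suc n} h (suc x) = begin
  signedSum h
    ≡⟨ signedSum-∷ h ⟩
  signedSum (h ∘ (false ∷_)) ℤ.+ -1ℤ ℤ.* signedSum (h ∘ (true ∷_))
    ≡⟨ cong₂ (λ y z → y ℤ.+ -1ℤ ℤ.* z)
         (signedSum-insertAt (h ∘ (false ∷_)) x) (signedSum-insertAt (h ∘ (true ∷_)) x) ⟩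
  (part false false ℤ.+ -1ℤ ℤ.* part true false) ℤ.+ -1ℤ ℤ.* (part false true ℤ.+ -1ℤ ℤ.* part true true)
    ≡⟨ interchange (part false false) (part true false) (part false true) (part true true) ⟩
  (part false false ℤ.+ -1ℤ ℤ.* part false true) ℤ.+ -1ℤ ℤ.* (part true false ℤ.+ -1ℤ ℤ.* part true true)
    ≡⟨ cong₂ (λ y z → y ℤ.+ -1ℤ ℤ.* z)
         (signedSum-∷ (λ S → h (insertAt S (suc x) false))) (signedSum-∷ (λ S → h (insertAt S (suc x) true))) ⟨
  signedSum (λ S → h (insertAt S (suc x) false)) ℤ.+ -1ℤ ℤ.* signedSum (λ S → h (insertAt S (suc x) true)) ∎
  where
  part : Bool → Bool → ℤ
  part b c = signedSum λ S → h (c ∷ insertAt S x b)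
  interchange : ∀ p q r s → (p ℤ.+ -1ℤ ℤ.* q) ℤ.+ -1ℤ ℤ.* (r ℤ.+ -1ℤ ℤ.* s) ≡
                            (p ℤ.+ -1ℤ ℤ.* r) ℤ.+ -1ℤ ℤ.* (q ℤ.+ -1ℤ ℤ.* s)
  interchange = solve-∀

infixl 6 _⊕_

_⊕_ : ∀ {n} → Subset n → Subset n → Subset n
_⊕_ = zipWith _xor_

-- Translation by `T` permutes the subsets and flips the parity of the size once for each element of
-- `T`. In the induction, a head that lies in `T` exchanges the two halves of the sum. Toggled
-- framings enter the recurrence through this sign.
signedSum-⊕ : ∀ {n} (h : Subset n → ℤ) T →
              signedSum (λ S → h (S ⊕ T)) ≡ -1ℤ ^ ∣ T ∣ ℤ.* signedSum h
signedSum-⊕ h []          = sym (ℤ.*-identityˡ (signedSum h))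
signedSum-⊕ h (false ∷ T) = begin
  signedSum (λ S → h (S ⊕ (false ∷ T)))
    ≡⟨ signedSum-∷ (λ S → h (S ⊕ (false ∷ T))) ⟩
  signedSum (λ S → h (false ∷ S ⊕ T)) ℤ.+ -1ℤ ℤ.* signedSum (λ S → h (true ∷ S ⊕ T))
    ≡⟨ cong₂ (λ y z → y ℤ.+ -1ℤ ℤ.* z) (signedSum-⊕ (h ∘ (false ∷_)) T) (signedSum-⊕ (h ∘ (true ∷_)) T) ⟩
  s ℤ.* signedSum (h ∘ (false ∷_)) ℤ.+ -1ℤ ℤ.* (s ℤ.* signedSum (h ∘ (true ∷_)))
    ≡⟨ factor s (signedSum (h ∘ (false ∷_))) (signedSum (h ∘ (true ∷_))) ⟩
  s ℤ.* (signedSum (h ∘ (false ∷_)) ℤ.+ -1ℤ ℤ.* signedSum (h ∘ (true ∷_)))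
    ≡⟨ cong (ℤ._*_ s) (signedSum-∷ h) ⟨
  s ℤ.* signedSum h ∎
  where
  s = -1ℤ ^ ∣ T ∣
  factor : ∀ s p q → s ℤ.* p ℤ.+ -1ℤ ℤ.* (s ℤ.* q) ≡ s ℤ.* (p ℤ.+ -1ℤ ℤ.* q)
  factor = solve-∀
signedSum-⊕ h (true ∷ T) = begin
  signedSum (λ S → h (S ⊕ (true ∷ T)))
    ≡⟨ signedSum-∷ (λ S → h (S ⊕ (true ∷ T))) ⟩
  signedSum (λ S → h (true ∷ S ⊕ T)) ℤ.+ -1ℤ ℤ.* signedSum (λ S → h (false ∷ S ⊕ T))
    ≡⟨ cong₂ (λ y z → y ℤ.+ -1ℤ ℤ.* z) (signedSum-⊕ (h ∘ (true ∷_)) T) (signedSum-⊕ (h ∘ (false ∷_)) T) ⟩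
  s ℤ.* signedSum (h ∘ (true ∷_)) ℤ.+ -1ℤ ℤ.* (s ℤ.* signedSum (h ∘ (false ∷_)))
    ≡⟨ factor s (signedSum (h ∘ (false ∷_))) (signedSum (h ∘ (true ∷_))) ⟩
  -1ℤ ℤ.* s ℤ.* (signedSum (h ∘ (false ∷_)) ℤ.+ -1ℤ ℤ.* signedSum (h ∘ (true ∷_)))
    ≡⟨ cong (ℤ._*_ (-1ℤ ℤ.* s)) (signedSum-∷ h) ⟨
  -1ℤ ℤ.* s ℤ.* signedSum h ∎
  where
  s = -1ℤ ^ ∣ T ∣
  factor : ∀ s p q → s ℤ.* q ℤ.+ -1ℤ ℤ.* (s ℤ.* p) ≡ -1ℤ ℤ.* s ℤ.* (p ℤ.+ -1ℤ ℤ.* q)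
  factor = solve-∀

∣insertAt∣ : ∀ {n} (S : Subset n) x b → ∣ insertAt S x b ∣ ≡ ∣ b ∷ S ∣
∣insertAt∣ S           zero    b     = refl
∣insertAt∣ (false ∷ S) (suc x) false = ∣insertAt∣ S x false
∣insertAt∣ (false ∷ S) (suc x) true  = ∣insertAt∣ S x true
∣insertAt∣ (true ∷ S)  (suc x) false = cong suc (∣insertAt∣ S x false)
∣insertAt∣ (true ∷ S)  (suc x) true  = cong suc (∣insertAt∣ S x true)

tabulate-punchIn : ∀ {n} {A : Set} (f : Fin (suc n) → A) x →
                   tabulate f ≡ insertAt (tabulate (f ∘ punchIn x)) x (f x)
tabulate-punchIn         f zero    = refl
tabulate-punchIn {suc n} f (suc x) = cong (f zero ∷_) (tabulate-punchIn (f ∘ suc) x)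

∣tabulate∣-punchIn : ∀ {n} (f : Fin (suc n) → Bool) x →
                     ∣ tabulate f ∣ ≡ ∣ f x ∷ tabulate (f ∘ punchIn x) ∣
∣tabulate∣-punchIn f x =
  trans (cong ∣_∣ (tabulate-punchIn f x)) (∣insertAt∣ (tabulate (f ∘ punchIn x)) x (f x))

fromℚᵘ-homo-* : ∀ p q → ℚ.fromℚᵘ p * ℚ.fromℚᵘ q ≡ ℚ.fromℚᵘ (p ℚᵘ.* q)
fromℚᵘ-homo-* p q = ℚ.toℚᵘ-injective (ℚᵘ.≃-trans (ℚ.toℚᵘ-homo-* (ℚ.fromℚᵘ p) (ℚ.fromℚᵘ q))
  (ℚᵘ.≃-trans (ℚᵘ.*-cong (ℚ.toℚᵘ-fromℚᵘ p) (ℚ.toℚᵘ-fromℚᵘ q)) (ℚᵘ.≃-sym (ℚ.toℚᵘ-fromℚᵘ (p ℚᵘ.* q)))))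

fromℚᵘ-homo-+ : ∀ p q → ℚ.fromℚᵘ p + ℚ.fromℚᵘ q ≡ ℚ.fromℚᵘ (p ℚᵘ.+ q)
fromℚᵘ-homo-+ p q = ℚ.toℚᵘ-injective (ℚᵘ.≃-trans (ℚ.toℚᵘ-homo-+ (ℚ.fromℚᵘ p) (ℚ.fromℚᵘ q))
  (ℚᵘ.≃-trans (ℚᵘ.+-cong (ℚ.toℚᵘ-fromℚᵘ p) (ℚ.toℚᵘ-fromℚᵘ q)) (ℚᵘ.≃-sym (ℚ.toℚᵘ-fromℚᵘ (p ℚᵘ.+ q)))))

-- With a successor as denominator, `p / suc m` is `fromℚᵘ (mkℚᵘ p m)` by definition. The
-- computation takes place among unnormalised fractions, and reduction to lowest terms is never
-- unfolded.
/-*-/ : ∀ p q m n .{{_ : ℕ.NonZero m}} .{{_ : ℕ.NonZero n}} .{{_ : ℕ.NonZero (m ℕ.* n)}} →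
        (p / m) * (q / n) ≡ (p ℤ.* q) / (m ℕ.* n)
/-*-/ p q (suc m) (suc n) = fromℚᵘ-homo-* (mkℚᵘ p m) (mkℚᵘ q n)

/-+-/ : ∀ p q d .{{_ : ℕ.NonZero d}} → (p / d) + (q / d) ≡ (p ℤ.+ q) / d
/-+-/ p q (suc d) = trans (fromℚᵘ-homo-+ (mkℚᵘ p d) (mkℚᵘ q d))
  (ℚ.fromℚᵘ-cong {mkℚᵘ p d ℚᵘ.+ mkℚᵘ q d} {mkℚᵘ (p ℤ.+ q) d} (*≡* (begin
    (p ℤ.* + suc d ℤ.+ q ℤ.* + suc d) ℤ.* + suc d  ≡⟨ cong (ℤ._* + suc d) (ℤ.*-distribʳ-+ (+ suc d) p q) ⟨
    (p ℤ.+ q) ℤ.* + suc d ℤ.* + suc d              ≡⟨ ℤ.*-assoc (p ℤ.+ q) (+ suc d) (+ suc d) ⟩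
    (p ℤ.+ q) ℤ.* (+ suc d ℤ.* + suc d)            ≡⟨ cong ((p ℤ.+ q) ℤ.*_) (ℤ.pos-* (suc d) (suc d)) ⟨
    (p ℤ.+ q) ℤ.* + (suc d ℕ.* suc d)              ∎)))

-- Here `d` stands for the denominator `2 ^ n` after two deletions: one deleted vertex leaves
-- `2 * d`, and the original graph has `2 * (2 * d)`.
/-combine : ∀ s₁ s₂ z₁ z₂ z₃ d .{{_ : ℕ.NonZero d}}
            .{{_ : ℕ.NonZero (2 ℕ.* d)}} .{{_ : ℕ.NonZero (2 ℕ.* (2 ℕ.* d))}} →
            (s₁ ℤ.* z₁ ℤ.+ s₂ ℤ.* z₂ ℤ.+ + 1 ℤ.* z₃) / (2 ℕ.* (2 ℕ.* d)) ≡
            (s₁ / 2) * (z₁ / (2 ℕ.* d)) + (s₂ / 4) * (z₂ / d) + ((+ 1) / 4) * (z₃ / d)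
/-combine s₁ s₂ z₁ z₂ z₃ d = sym (begin
  (s₁ / 2) * (z₁ / (2 ℕ.* d)) + (s₂ / 4) * (z₂ / d) + ((+ 1) / 4) * (z₃ / d)
    ≡⟨ cong₂ _+_ (cong₂ _+_ (/-*-/ s₁ z₁ 2 (2 ℕ.* d)) (quarter s₂ z₂)) (quarter (+ 1) z₃) ⟩
  (s₁ ℤ.* z₁) / D + (s₂ ℤ.* z₂) / D + (+ 1 ℤ.* z₃) / D
    ≡⟨ cong (ℚ._+ (+ 1 ℤ.* z₃) / D) (/-+-/ (s₁ ℤ.* z₁) (s₂ ℤ.* z₂) D) ⟩
  (s₁ ℤ.* z₁ ℤ.+ s₂ ℤ.* z₂) / D + (+ 1 ℤ.* z₃) / D
    ≡⟨ /-+-/ (s₁ ℤ.* z₁ ℤ.+ s₂ ℤ.* z₂) (+ 1 ℤ.* z₃) D ⟩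
  (s₁ ℤ.* z₁ ℤ.+ s₂ ℤ.* z₂ ℤ.+ + 1 ℤ.* z₃) / D ∎)
  where
  D = 2 ℕ.* (2 ℕ.* d)
  quarter : ∀ s z → (s / 4) * (z / d) ≡ (s ℤ.* z) / D
  quarter s z = trans (/-*-/ s z 4 d {{_}} {{_}} {{ℕ.m*n≢0 4 d}})
                      (ℚ./-cong {s ℤ.* z} {{ℕ.m*n≢0 4 d}} refl (ℕ.*-assoc 2 2 d))

-- Elimination in adjacency matrices

adjacencyMatrix-diag : ∀ {n} (G : Graph n) f u → adjacencyMatrix (G ⟨ f ⟩) u u ≡ f u
adjacencyMatrix-diag G f u = cong (λ d → if d then f u else adj G u u) (does-≟-refl u)

adjacencyMatrix-off : ∀ {n} (G : Graph n) f {u v} → u ≢ v → adjacencyMatrix (G ⟨ f ⟩) u v ≡ adj G u v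
adjacencyMatrix-off G f {u} {v} u≢v = cong (λ d → if d then f u else adj G u v) (dec-false (u ≟ v) u≢v)

adjacencyMatrix-unique : ∀ {n} (G : Graph n) f {N : Matrix n n} → (∀ u → N u u ≡ f u) →
                         (∀ {u v} → u ≢ v → N u v ≡ adj G u v) → ∀ u v → N u v ≡ adjacencyMatrix (G ⟨ f ⟩) u v
adjacencyMatrix-unique G f diag off u v with u ≟ v
... | yes refl = diag u
... | no  u≢v  = off u≢v

xor-∧-if : ∀ b c e → (if b ∧ c then not e else e) ≡ e xor (b ∧ c)
xor-∧-if false c     e     = sym (xor-identityʳ e)
xor-∧-if true  false e     = sym (xor-identityʳ e)
xor-∧-if true  true  e     = sym (xor-comm e true)

-- Inverting the edges within the neighbourhood adds, off the diagonal, the product of the row of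
-- `x` with itself. This is the correction term of the Schur complement at `(x , x)`.
invertedDelete-adj : ∀ {n} (G : Graph (suc n)) x {u v} → u ≢ v →
                     adj (invertedDelete G x) u v ≡
                     adj G (punchIn x u) (punchIn x v) xor (adj G x (punchIn x u) ∧ adj G x (punchIn x v))
invertedDelete-adj G x {u} {v} u≢v = begin
  (if not (does (p ≟ q)) ∧ (lookup A p ∧ lookup A q) then not (adj G p q) else adj G p q)
    ≡⟨ cong (λ d → if not d ∧ (lookup A p ∧ lookup A q) then not (adj G p q) else adj G p q)
            (dec-false (p ≟ q) (u≢v ∘ punchIn-injective x u v)) ⟩
  (if lookup A p ∧ lookup A q then not (adj G p q) else adj G p q)
    ≡⟨ xor-∧-if (lookup A p) (lookup A q) (adj G p q) ⟩
  adj G p q xor (lookup A p ∧ lookup A q)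
    ≡⟨ cong₂ (λ y z → adj G p q xor (y ∧ z)) (lookup∘tabulate (adj G x) p) (lookup∘tabulate (adj G x) q) ⟩
  adj G p q xor (adj G x p ∧ adj G x q) ∎
  where
  p = punchIn x u
  q = punchIn x v
  A = neighbourhood G x

-- The framing 1 of `x` is the pivot. On the diagonal the correction is `α u ∧ α u`, that is `α u`,
-- so the framings of the neighbours are toggled along with the edges among them.
η-framed : ∀ {n} (G : Graph (suc n)) x S →
           η (G ⟨ lookup (insertAt S x true) ⟩) ≡
           η (invertedDelete G x ⟨ lookup (S ⊕ tabulate (adj G x ∘ punchIn x)) ⟩)
η-framed G x S = trans (corank-schur M x x (trans (adjacencyMatrix-diag G f x) (insertAt-lookup S x true)))
  (corank-cong (adjacencyMatrix-unique (invertedDelete G x) _ diag off))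
  where
  f = lookup (insertAt S x true)
  M = adjacencyMatrix (G ⟨ f ⟩)
  T = tabulate (adj G x ∘ punchIn x)

  column : ∀ u → M (punchIn x u) x ≡ adj G x (punchIn x u)
  column u = trans (adjacencyMatrix-off G f (punchInᵢ≢i x u)) (adj-sym G (punchIn x u) x)

  row : ∀ u → M x (punchIn x u) ≡ adj G x (punchIn x u)
  row u = adjacencyMatrix-off G f (punchInᵢ≢i x u ∘ sym)

  diag : ∀ u → schur M x x u u ≡ lookup (S ⊕ T) u
  diag u = begin
    M (punchIn x u) (punchIn x u) xor (M (punchIn x u) x ∧ M x (punchIn x u))
      ≡⟨ cong₂ _xor_ (adjacencyMatrix-diag G f (punchIn x u)) (cong₂ _∧_ (column u) (row u)) ⟩
    f (punchIn x u) xor (adj G x (punchIn x u) ∧ adj G x (punchIn x u))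
      ≡⟨ cong₂ _xor_ (insertAt-punchIn S x true u) (∧-idem (adj G x (punchIn x u))) ⟩
    lookup S u xor adj G x (punchIn x u)
      ≡⟨ cong (lookup S u xor_) (lookup∘tabulate (adj G x ∘ punchIn x) u) ⟨
    lookup S u xor lookup T u
      ≡⟨ lookup-zipWith _xor_ u S T ⟨
    lookup (S ⊕ T) u ∎

  off : ∀ {u v} → u ≢ v → schur M x x u v ≡ adj (invertedDelete G x) u v
  off {u} {v} u≢v = begin
    M (punchIn x u) (punchIn x v) xor (M (punchIn x u) x ∧ M x (punchIn x v))
      ≡⟨ cong₂ _xor_ (adjacencyMatrix-off G f (u≢v ∘ punchIn-injective x u v)) (cong₂ _∧_ (column u) (row v)) ⟩
    adj G (punchIn x u) (punchIn x v) xor (adj G x (punchIn x u) ∧ adj G x (punchIn x v))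
      ≡⟨ invertedDelete-adj G x u≢v ⟨
    adj (invertedDelete G x) u v ∎

-- Iterated 2T transforms

module _ {n} (G : Graph n) {a b : Fin n} where

  -- Away from `a`, the transform adds row `a` to row `b` and column `a` to column `b`. At `(b , b)`
  -- the two contributions cancel, so `xor` can replace the disjunction in the definition.
  twoT-adj : ∀ {u v} → u ≢ a → v ≢ a →
             adj (twoT G a b) u v ≡
             adj G u v xor ((does (u ≟ b) ∧ adj G a v) xor (does (v ≟ b) ∧ adj G a u))
  twoT-adj {u} {v} u≢a v≢a with u ≟ a | v ≟ a | u ≟ b | v ≟ b
  ... | yes u≡a | _       | _        | _        = contradiction u≡a u≢a
  ... | no _    | yes v≡a | _        | _        = contradiction v≡a v≢a
  ... | no _    | no _    | yes refl | yes refl = cong (adj G u u xor_) (sym (xor-same (adj G a u)))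
  ... | no _    | no _    | yes refl | no _     = cong (adj G u v xor_) (trans (∨-identityʳ _) (sym (xor-identityʳ _)))
  ... | no _    | no _    | no _     | yes refl = refl
  ... | no _    | no _    | no _     | no _     = refl

  -- Successive transforms with the same `a` therefore all add the same row.
  twoT-centre : a ≢ b → ∀ w → adj (twoT G a b) a w ≡ adj G a w
  twoT-centre a≢b w with a ≟ b | a ≟ a
  ... | yes a≡b | _       = contradiction a≡b a≢b
  ... | no _    | no a≢a  = contradiction refl a≢a
  ... | no _    | yes _   = trans (cong (adj G a w xor_) (∧-zeroʳ (does (w ≟ b)))) (xor-identityʳ (adj G a w))

-- A count modulo 2, so that the contributions of successive transforms add up. For injective `b` it
-- is the indicator function of the image.
occurrences : ∀ {n k} → Vector (Fin n) k → Fin n → 𝔽₂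
occurrences b u = sum λ i → does (u ≟ b i)

occurrences-∉ : ∀ {n k} (b : Vector (Fin n) k) {u} → (∀ i → u ≢ b i) → occurrences b u ≡ false
occurrences-∉ {k = k} b {u} u∉b =
  trans (sum-cong-≗ λ i → dec-false (u ≟ b i) (u∉b i)) (sum-replicate-zero k)

occurrences-∈ : ∀ {n k} (b : Vector (Fin n) k) → Injective _≡_ _≡_ b → ∀ j → occurrences b (b j) ≡ true
occurrences-∈ b inj zero = cong₂ _xor_ (does-≟-refl (b zero))
  (occurrences-∉ (tail b) λ i eq → contradiction (inj eq) λ ())
occurrences-∈ b inj (suc j) = cong₂ _xor_
  (dec-false (b (suc j) ≟ b zero) λ eq → contradiction (inj eq) λ ())
  (occurrences-∈ (tail b) (λ eq → suc-injective (inj eq)) j)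

spread-adj : ∀ {n k} (G : Graph n) {a} (b : Vector (Fin n) k) → (∀ i → a ≢ b i) → ∀ {u v} → u ≢ a → v ≢ a →
             adj (foldl (λ H → twoT H a) G b) u v ≡
             adj G u v xor ((occurrences b u ∧ adj G a v) xor (occurrences b v ∧ adj G a u))
spread-adj {k = zero}  G b _ u≢a v≢a = sym (xor-identityʳ _)
spread-adj {k = suc k} G {a} b a∉b {u} {v} u≢a v≢a = begin
  adj (foldl (λ H → twoT H a) H (tail b)) u v
    ≡⟨ spread-adj H (tail b) (a∉b ∘ suc) u≢a v≢a ⟩
  adj H u v xor ((occurrences (tail b) u ∧ adj H a v) xor (occurrences (tail b) v ∧ adj H a u))
    ≡⟨ cong₂ _xor_ (twoT-adj G u≢a v≢a)
         (cong₂ (λ y z → (occurrences (tail b) u ∧ y) xor (occurrences (tail b) v ∧ z))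
           (twoT-centre G (a∉b zero) v) (twoT-centre G (a∉b zero) u)) ⟩
  (adj G u v xor ((does (u ≟ head b) ∧ adj G a v) xor (does (v ≟ head b) ∧ adj G a u))) xor
    ((occurrences (tail b) u ∧ adj G a v) xor (occurrences (tail b) v ∧ adj G a u))
    ≡⟨ regroup (adj G u v) (does (u ≟ head b)) (adj G a v) (does (v ≟ head b)) (adj G a u)
         (occurrences (tail b) u) (occurrences (tail b) v) ⟩
  adj G u v xor ((occurrences b u ∧ adj G a v) xor (occurrences b v ∧ adj G a u)) ∎
  where
  H = twoT G a (head b)
  open xor-∧-Solver
  regroup : ∀ e d y d′ z o o′ → (e xor ((d ∧ y) xor (d′ ∧ z))) xor ((o ∧ y) xor (o′ ∧ z)) ≡
                                 e xor (((d xor o) ∧ y) xor ((d′ xor o′) ∧ z))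
  regroup = solve 7 (λ e d y d′ z o o′ → (e :+ (d :* y :+ d′ :* z)) :+ (o :* y :+ o′ :* z) :=
                                          e :+ ((d :+ o) :* y :+ (d′ :+ o′) :* z)) refl

-- The order in which two vertices are removed does not affect the labels of the rest. Eliminating
-- at `(x , a)` and then at `(a , x)` removes the rows in one order and the columns in the other.
punchIn-swap : ∀ {n} {x a : Fin (suc (suc n))} (x≢a : x ≢ a) (a≢x : a ≢ x) u →
               punchIn a (punchIn (punchOut a≢x) u) ≡ punchIn x (punchIn (punchOut x≢a) u)
punchIn-swap {x = zero}  {zero}  x≢a a≢x u = contradiction refl x≢a
punchIn-swap {x = zero}  {suc a} x≢a a≢x u = refl
punchIn-swap {x = suc x} {zero}  x≢a a≢x u = refl
punchIn-swap {x = suc x} {suc a} x≢a a≢x zero = refl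
punchIn-swap {suc n} {x = suc x} {suc a} x≢a a≢x (suc u) =
  cong suc (punchIn-swap (x≢a ∘ cong suc) (a≢x ∘ cong suc) u)

-- Two successive pivots

module _ {n} (M : Matrix (suc (suc n)) (suc (suc n))) {x a : Fin (suc (suc n))} (x≢a : x ≢ a) where

  private
    keep : Fin n → Fin (suc (suc n))
    keep u = punchIn x (punchIn (punchOut x≢a) u)

  -- The Schur complement at (x , a) and then at (a , x), simplified by M x x ≡ false.
  schur₂ : Matrix n n
  schur₂ u v = (M (keep u) (keep v) xor (M (keep u) a ∧ M x (keep v))) xor
               (M (keep u) x ∧ (M a (keep v) xor (M a a ∧ M x (keep v))))

  corank-schur₂ : M x x ≡ false → M x a ≡ true → M a x ≡ true → corank M ≡ corank schur₂
  corank-schur₂ Mₓₓ Mₓₐ Mₐₓ = begin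
    corank M                          ≡⟨ corank-schur M x a Mₓₐ ⟩
    corank M′                         ≡⟨ corank-schur M′ a′ x′ M′ₐₓ ⟩
    corank (schur M′ a′ x′)           ≡⟨ corank-cong entries ⟩
    corank schur₂                     ∎
    where
    M′ = schur M x a
    a′ = punchOut x≢a
    x′ = punchOut (x≢a ∘ sym)

    -- Since `M x x` is 0, the first elimination leaves column `x` unchanged. In particular the
    -- second pivot is still 1.
    M′ᵢₓ : ∀ r → M′ r x′ ≡ M (punchIn x r) x
    M′ᵢₓ r = begin
      M (punchIn x r) (punchIn a x′) xor (M (punchIn x r) a ∧ M x (punchIn a x′))
        ≡⟨ cong (λ z → M (punchIn x r) z xor (M (punchIn x r) a ∧ M x z)) (punchIn-punchOut (x≢a ∘ sym)) ⟩
      M (punchIn x r) x xor (M (punchIn x r) a ∧ M x x)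
        ≡⟨ cong (λ z → M (punchIn x r) x xor (M (punchIn x r) a ∧ z)) Mₓₓ ⟩
      M (punchIn x r) x xor (M (punchIn x r) a ∧ false)
        ≡⟨ cong (M (punchIn x r) x xor_) (∧-zeroʳ _) ⟩
      M (punchIn x r) x xor false
        ≡⟨ xor-identityʳ _ ⟩
      M (punchIn x r) x ∎

    M′ₐₓ : M′ a′ x′ ≡ true
    M′ₐₓ = trans (M′ᵢₓ a′) (trans (cong (λ z → M z x) (punchIn-punchOut x≢a)) Mₐₓ)

    entries : ∀ u v → schur M′ a′ x′ u v ≡ schur₂ u v
    entries u v = begin
      M′ (punchIn a′ u) (punchIn x′ v) xor (M′ (punchIn a′ u) x′ ∧ M′ a′ (punchIn x′ v))
        ≡⟨ cong (λ z → M′ (punchIn a′ u) (punchIn x′ v) xor (z ∧ M′ a′ (punchIn x′ v))) (M′ᵢₓ (punchIn a′ u)) ⟩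
      M′ (punchIn a′ u) (punchIn x′ v) xor (M (keep u) x ∧ M′ a′ (punchIn x′ v))
        ≡⟨ cong₂ (λ y z → (M (keep u) z xor (M (keep u) a ∧ M x z)) xor
                          (M (keep u) x ∧ (M y z xor (M y a ∧ M x z))))
             (punchIn-punchOut x≢a) (punchIn-swap x≢a (x≢a ∘ sym) v) ⟩
      schur₂ u v ∎

-- Elimination of a vertex and one of its neighbours

module _ {n j} (G : Graph (suc (suc n))) (x : Fin (suc (suc n))) (a : Vector (Fin (suc (suc n))) (suc j))
         (enum : EnumeratesNeighbours G x a) where

  open EnumeratesNeighbours enum

  private
    a′ : Vector (Fin (suc n)) (suc j)
    a′ = neighboursAfterDelete G x a enum

    centre : Fin (suc n)
    centre = head a′

    punchIn-a′ : ∀ i → punchIn x (a′ i) ≡ a i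
    punchIn-a′ i = punchIn-punchOut (Adj⇒≢ G (adjacent i))

    a′-injective : Injective _≡_ _≡_ a′
    a′-injective {i} {l} eq = injective
      (trans (sym (punchIn-a′ i)) (trans (cong (punchIn x) eq) (punchIn-a′ l)))

    centre∉ : ∀ i → centre ≢ tail a′ i
    centre∉ i eq = contradiction (a′-injective eq) λ ()

    keep : Fin n → Fin (suc (suc n))
    keep u = punchIn x (punchIn centre u)

    α ν : Fin n → 𝔽₂
    α u = adj G x (keep u)
    ν u = adj G (a zero) (keep u)

    -- Every neighbour of `x` other than `a₁` occurs exactly once in the tail of the enumeration.
    -- Index `zero` is impossible, since it would make a kept vertex equal to the deleted `centre`.
    occurrences-a′ : ∀ u → occurrences (tail a′) (punchIn centre u) ≡ α u
    occurrences-a′ u with α u in eq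
    ... | false = occurrences-∉ (tail a′) λ i eq′ → contradiction
      (begin
        false                             ≡⟨ eq ⟨
        α u                               ≡⟨ cong (adj G x ∘ punchIn x) eq′ ⟩
        adj G x (punchIn x (a′ (suc i)))  ≡⟨ cong (adj G x) (punchIn-a′ (suc i)) ⟩
        adj G x (a (suc i))               ≡⟨ adjacent (suc i) ⟩
        true                              ∎) λ ()
    ... | true with complete (keep u) eq
    ...   | zero  , a₀≡u = contradiction
      (punchIn-injective x _ _ (trans (sym a₀≡u) (sym (punchIn-a′ zero)))) (punchInᵢ≢i centre u)
    ...   | suc i , aᵢ≡u = trans
      (cong (occurrences (tail a′)) (punchIn-injective x _ _ (trans (sym aᵢ≡u) (sym (punchIn-a′ (suc i))))))
      (occurrences-∈ (tail a′) (λ eq′ → suc-injective (a′-injective eq′)) i)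

    spreadAndDelete-adj : ∀ (H : Graph (suc n)) u v →
      adj (spreadAndDelete H a′) u v ≡
      adj H (punchIn centre u) (punchIn centre v) xor
        ((α u ∧ adj H centre (punchIn centre v)) xor (α v ∧ adj H centre (punchIn centre u)))
    spreadAndDelete-adj H u v = trans
      (spread-adj H (tail a′) centre∉ (punchInᵢ≢i centre u) (punchInᵢ≢i centre v))
      (cong₂ (λ y z → adj H (punchIn centre u) (punchIn centre v) xor
                ((y ∧ adj H centre (punchIn centre v)) xor (z ∧ adj H centre (punchIn centre u))))
             (occurrences-a′ u) (occurrences-a′ v))

    spreadDeleted-adj : ∀ u v → adj (spreadAndDelete (delete G x) a′) u v ≡
                        adj G (keep u) (keep v) xor ((α u ∧ ν v) xor (α v ∧ ν u))
    spreadDeleted-adj u v = trans (spreadAndDelete-adj (delete G x) u v)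
      (cong (λ c → adj G (keep u) (keep v) xor ((α u ∧ adj G c (keep v)) xor (α v ∧ adj G c (keep u))))
            (punchIn-a′ zero))

    -- `a₁` is itself a neighbour of `x`, so the inversion also changes its row.
    invertedDelete-centre : ∀ u → adj (invertedDelete G x) centre (punchIn centre u) ≡ ν u xor α u
    invertedDelete-centre u = begin
      adj (invertedDelete G x) centre (punchIn centre u)
        ≡⟨ invertedDelete-adj G x (punchInᵢ≢i centre u ∘ sym) ⟩
      adj G (punchIn x centre) (keep u) xor (adj G x (punchIn x centre) ∧ α u)
        ≡⟨ cong (λ c → adj G c (keep u) xor (adj G x c ∧ α u)) (punchIn-a′ zero) ⟩
      ν u xor (adj G x (a zero) ∧ α u)
        ≡⟨ cong (λ e → ν u xor (e ∧ α u)) (adjacent zero) ⟩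
      ν u xor α u ∎

    -- The transforms now add the row `ν + α` of `a₁` in place of `ν`. The two extra terms
    -- `α u ∧ α v` cancel, and the one due to the inversion remains.
    spreadInverted-adj : ∀ {u v} → u ≢ v → adj (spreadAndDelete (invertedDelete G x) a′) u v ≡
                         adj G (keep u) (keep v) xor (α u ∧ α v) xor ((α u ∧ ν v) xor (α v ∧ ν u))
    spreadInverted-adj {u} {v} u≢v = begin
      adj (spreadAndDelete (invertedDelete G x) a′) u v
        ≡⟨ spreadAndDelete-adj (invertedDelete G x) u v ⟩
      adj (invertedDelete G x) (punchIn centre u) (punchIn centre v) xor
        ((α u ∧ adj (invertedDelete G x) centre (punchIn centre v)) xor
         (α v ∧ adj (invertedDelete G x) centre (punchIn centre u)))
        ≡⟨ cong₂ _xor_ (invertedDelete-adj G x (u≢v ∘ punchIn-injective centre u v))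
             (cong₂ (λ y z → (α u ∧ y) xor (α v ∧ z)) (invertedDelete-centre v) (invertedDelete-centre u)) ⟩
      (adj G (keep u) (keep v) xor (α u ∧ α v)) xor ((α u ∧ (ν v xor α v)) xor (α v ∧ (ν u xor α u)))
        ≡⟨ cancel (adj G (keep u) (keep v)) (α u) (α v) (ν u) (ν v) ⟩
      adj G (keep u) (keep v) xor (α u ∧ α v) xor ((α u ∧ ν v) xor (α v ∧ ν u)) ∎
      where
      open xor-∧-Solver
      cancel : ∀ e p q r s → (e xor (p ∧ q)) xor ((p ∧ (s xor q)) xor (q ∧ (r xor p))) ≡
                             e xor (p ∧ q) xor ((p ∧ s) xor (q ∧ r))
      cancel = solve 5 (λ e p q r s → (e :+ p :* q) :+ (p :* (s :+ q) :+ q :* (r :+ p)) :=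
                                      e :+ (p :* q :+ (p :* s :+ q :* r))) refl

  module _ (S : Subset n) (b : Bool) where

    private
      f = lookup (insertAt (insertAt S centre b) x false)
      M = adjacencyMatrix (G ⟨ f ⟩)
      x≢a = Adj⇒≢ G (adjacent zero)

      f-keep : ∀ u → f (keep u) ≡ lookup S u
      f-keep u = trans (insertAt-punchIn (insertAt S centre b) x false (punchIn centre u))
                       (insertAt-punchIn S centre b u)

      f-a : f (a zero) ≡ b
      f-a = trans (cong f (sym (punchIn-a′ zero)))
                  (trans (insertAt-punchIn (insertAt S centre b) x false centre) (insertAt-lookup S centre b))

      x≢keep : ∀ u → x ≢ keep u
      x≢keep u eq = punchInᵢ≢i x (punchIn centre u) (sym eq)

      a≢keep : ∀ u → a zero ≢ keep u
      a≢keep u eq = punchInᵢ≢i centre u (punchIn-injective x _ _ (trans (sym eq) (sym (punchIn-a′ zero))))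

      Mₓₓ : M x x ≡ false
      Mₓₓ = trans (adjacencyMatrix-diag G f x) (insertAt-lookup (insertAt S centre b) x false)

      Mₓₐ : M x (a zero) ≡ true
      Mₓₐ = trans (adjacencyMatrix-off G f x≢a) (adjacent zero)

      Mₐₓ : M (a zero) x ≡ true
      Mₐₓ = trans (adjacencyMatrix-off G f (x≢a ∘ sym)) (trans (adj-sym G (a zero) x) (adjacent zero))

      entries : ∀ u v → schur₂ M x≢a u v ≡
                        (M (keep u) (keep v) xor (ν u ∧ α v)) xor (α u ∧ (ν v xor (b ∧ α v)))
      entries u v = cong₂ _xor_
        (cong (M (keep u) (keep v) xor_) (cong₂ _∧_
          (trans (adjacencyMatrix-off G f (a≢keep u ∘ sym)) (adj-sym G (keep u) (a zero)))
          (adjacencyMatrix-off G f (x≢keep v))))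
        (cong₂ _∧_
          (trans (adjacencyMatrix-off G f (x≢keep u ∘ sym)) (adj-sym G (keep u) x))
          (cong₂ _xor_ (adjacencyMatrix-off G f (a≢keep v))
            (cong₂ _∧_ (trans (adjacencyMatrix-diag G f (a zero)) f-a) (adjacencyMatrix-off G f (x≢keep v)))))

    -- Treats both framings `b` of `a₁` at once. On the diagonal the two mixed terms in `α` and `ν`
    -- coincide and cancel, which leaves a change of framing by `b ∧ α u`.
    η-eliminate : ∀ (H : Graph n) g → (∀ u → lookup S u xor (b ∧ α u) ≡ g u) →
                  (∀ {u v} → u ≢ v →
                    adj G (keep u) (keep v) xor (b ∧ (α u ∧ α v)) xor ((α u ∧ ν v) xor (α v ∧ ν u)) ≡
                    adj H u v) →
                  η (G ⟨ f ⟩) ≡ η (H ⟨ g ⟩)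
    η-eliminate H g diag off =
      trans (corank-schur₂ M x≢a Mₓₓ Mₓₐ Mₐₓ) (corank-cong (adjacencyMatrix-unique H g diag′ off′))
      where
      open xor-∧-Solver
      -- The case split on p stands in for p ∧ p ≡ p, which the ring solver does not know.
      diagonal : ∀ e p r b → (e xor (r ∧ p)) xor (p ∧ (r xor (b ∧ p))) ≡ e xor (b ∧ p)
      diagonal e false r b = trans (xor-identityʳ _) (cong (e xor_) (trans (∧-zeroʳ r) (sym (∧-zeroʳ b))))
      diagonal e true  r b =
        solve 3 (λ e r b → (e :+ r :* con true) :+ (r :+ b :* con true) := e :+ b :* con true) refl e r b
      offDiagonal : ∀ e p q r s b → (e xor (r ∧ q)) xor (p ∧ (s xor (b ∧ q))) ≡
                                    e xor (b ∧ (p ∧ q)) xor ((p ∧ s) xor (q ∧ r))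
      offDiagonal = solve 6 (λ e p q r s b → (e :+ r :* q) :+ p :* (s :+ b :* q) :=
                                             e :+ (b :* (p :* q) :+ (p :* s :+ q :* r))) refl

      diag′ : ∀ u → schur₂ M x≢a u u ≡ g u
      diag′ u = begin
        schur₂ M x≢a u u
          ≡⟨ entries u u ⟩
        (M (keep u) (keep u) xor (ν u ∧ α u)) xor (α u ∧ (ν u xor (b ∧ α u)))
          ≡⟨ cong (λ e → (e xor (ν u ∧ α u)) xor (α u ∧ (ν u xor (b ∧ α u))))
               (trans (adjacencyMatrix-diag G f (keep u)) (f-keep u)) ⟩
        (lookup S u xor (ν u ∧ α u)) xor (α u ∧ (ν u xor (b ∧ α u)))
          ≡⟨ diagonal (lookup S u) (α u) (ν u) b ⟩
        lookup S u xor (b ∧ α u)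
          ≡⟨ diag u ⟩
        g u ∎

      off′ : ∀ {u v} → u ≢ v → schur₂ M x≢a u v ≡ adj H u v
      off′ {u} {v} u≢v = begin
        schur₂ M x≢a u v
          ≡⟨ entries u v ⟩
        (M (keep u) (keep v) xor (ν u ∧ α v)) xor (α u ∧ (ν v xor (b ∧ α v)))
          ≡⟨ cong (λ e → (e xor (ν u ∧ α v)) xor (α u ∧ (ν v xor (b ∧ α v))))
               (adjacencyMatrix-off G f (u≢v ∘ punchIn-injective centre u v ∘ punchIn-injective x _ _)) ⟩
        (adj G (keep u) (keep v) xor (ν u ∧ α v)) xor (α u ∧ (ν v xor (b ∧ α v)))
          ≡⟨ offDiagonal (adj G (keep u) (keep v)) (α u) (α v) (ν u) (ν v) b ⟩
        adj G (keep u) (keep v) xor (b ∧ (α u ∧ α v)) xor ((α u ∧ ν v) xor (α v ∧ ν u))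
          ≡⟨ off u≢v ⟩
        adj H u v ∎

  η-unframed-false : ∀ S → η (G ⟨ lookup (insertAt (insertAt S centre false) x false) ⟩) ≡
                           η (spreadAndDelete (delete G x) a′ ⟨ lookup S ⟩)
  η-unframed-false S = η-eliminate S false (spreadAndDelete (delete G x) a′) (lookup S)
    (λ u → xor-identityʳ (lookup S u))
    (λ {u} {v} _ → sym (spreadDeleted-adj u v))

  -- With `b` equal to 1 the term `α u ∧ α v` survives. Off the diagonal it is the inversion within
  -- the neighbourhood of `x`, and on the diagonal it toggles the framings of the neighbours other
  -- than `a₁`.
  η-unframed-true : ∀ S → η (G ⟨ lookup (insertAt (insertAt S centre true) x false) ⟩) ≡
                          η (spreadAndDelete (invertedDelete G x) a′ ⟨ lookup (S ⊕ tabulate α) ⟩)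
  η-unframed-true S = η-eliminate S true (spreadAndDelete (invertedDelete G x) a′) (lookup (S ⊕ tabulate α))
    (λ u → trans (cong (lookup S u xor_) (sym (lookup∘tabulate α u))) (sym (lookup-zipWith _xor_ u S (tabulate α))))
    (λ u≢v → sym (spreadInverted-adj u≢v))

-- The recurrence for the numerators and for `ψ`

ψSum : ∀ {n} → Graph n → ℤ
ψSum G = signedSum λ V′ → + (3 ℕ.^ η (G ⟨ lookup V′ ⟩))

module _ {n j} (G : Graph (suc (suc n))) (x : Fin (suc (suc n))) (deg : degree G x ≡ suc j)
         (a : Vector (Fin (suc (suc n))) (suc j)) (enum : EnumeratesNeighbours G x a) where

  open EnumeratesNeighbours enum

  private
    k = suc j
    a′ = neighboursAfterDelete G x a enum
    α = adj G x ∘ punchIn x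
    β = α ∘ punchIn (head a′)
    pow3 = λ (m : ℕ) → + (3 ℕ.^ m)
    h = λ V′ → pow3 (η (G ⟨ lookup V′ ⟩))
    G₁ = invertedDelete G x
    G₂ = spreadAndDelete (invertedDelete G x) a′
    G₃ = spreadAndDelete (delete G x) a′

    ∣α∣ : ∣ tabulate α ∣ ≡ k
    ∣α∣ = begin
      ∣ tabulate α ∣              ≡⟨ cong (λ b → ∣ b ∷ tabulate α ∣) (loopless G x) ⟨
      ∣ adj G x x ∷ tabulate α ∣  ≡⟨ ∣tabulate∣-punchIn (adj G x) x ⟨
      degree G x                  ≡⟨ deg ⟩
      k                           ∎

    α-head : α (head a′) ≡ true
    α-head = trans (cong (adj G x) (punchIn-punchOut (Adj⇒≢ G (adjacent zero)))) (adjacent zero)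

    -- Deleting `a₁` removes one neighbour of `x`, so only `k - 1` framings are toggled in the
    -- second term.
    ∣β∣ : ∣ tabulate β ∣ ≡ j
    ∣β∣ = ℕ.suc-injective (begin
      suc ∣ tabulate β ∣            ≡⟨ cong (λ b → ∣ b ∷ tabulate β ∣) α-head ⟨
      ∣ α (head a′) ∷ tabulate β ∣  ≡⟨ ∣tabulate∣-punchIn α (head a′) ⟨
      ∣ tabulate α ∣                ≡⟨ ∣α∣ ⟩
      k                             ∎)

  -- Each sign has two sources. For `G₁`, framing 1 at `x` gives -1 and the `k` toggled framings
  -- give the rest. For `G₂`, framing 1 at `a₁` gives -1 and the `k - 1` toggled framings give the
  -- rest. For `G₃` both framings are 0 and nothing is toggled.
  ψSum-recurrence : ψSum G ≡ -1ℤ ^ suc k ℤ.* ψSum G₁ ℤ.+ -1ℤ ^ k ℤ.* ψSum G₂ ℤ.+ + 1 ℤ.* ψSum G₃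
  ψSum-recurrence = begin
    ψSum G
      ≡⟨ signedSum-insertAt h x ⟩
    signedSum (λ S → h (insertAt S x false)) ℤ.+ -1ℤ ℤ.* signedSum (λ S → h (insertAt S x true))
      ≡⟨ cong₂ (λ y z → y ℤ.+ -1ℤ ℤ.* z) unframed framed ⟩
    (ψSum G₃ ℤ.+ -1ℤ ℤ.* (-1ℤ ^ j ℤ.* ψSum G₂)) ℤ.+ -1ℤ ℤ.* (-1ℤ ^ k ℤ.* ψSum G₁)
      -- Both `-1ℤ ^ k` and `-1ℤ ^ suc k` unfold to multiples of `-1ℤ ^ j`, which the ring solver
      -- treats as a variable.
      ≡⟨ rearrange (-1ℤ ^ j) (ψSum G₁) (ψSum G₂) (ψSum G₃) ⟩
    -1ℤ ^ suc k ℤ.* ψSum G₁ ℤ.+ -1ℤ ^ k ℤ.* ψSum G₂ ℤ.+ + 1 ℤ.* ψSum G₃ ∎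
    where
    framed : signedSum (λ S → h (insertAt S x true)) ≡ -1ℤ ^ k ℤ.* ψSum G₁
    framed = begin
      signedSum (λ S → h (insertAt S x true))
        ≡⟨ signedSum-cong (λ S → cong pow3 (η-framed G x S)) ⟩
      signedSum (λ S → pow3 (η (G₁ ⟨ lookup (S ⊕ tabulate α) ⟩)))
        ≡⟨ signedSum-⊕ (λ S → pow3 (η (G₁ ⟨ lookup S ⟩))) (tabulate α) ⟩
      -1ℤ ^ ∣ tabulate α ∣ ℤ.* ψSum G₁
        ≡⟨ cong (λ m → -1ℤ ^ m ℤ.* ψSum G₁) ∣α∣ ⟩
      -1ℤ ^ k ℤ.* ψSum G₁ ∎

    unframed : signedSum (λ S → h (insertAt S x false)) ≡ ψSum G₃ ℤ.+ -1ℤ ℤ.* (-1ℤ ^ j ℤ.* ψSum G₂)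
    unframed = begin
      signedSum (λ S → h (insertAt S x false))
        ≡⟨ signedSum-insertAt (λ S → h (insertAt S x false)) (head a′) ⟩
      signedSum (λ S → h (insertAt (insertAt S (head a′) false) x false)) ℤ.+
        -1ℤ ℤ.* signedSum (λ S → h (insertAt (insertAt S (head a′) true) x false))
        ≡⟨ cong₂ (λ y z → y ℤ.+ -1ℤ ℤ.* z)
             (signedSum-cong λ S → cong pow3 (η-unframed-false G x a enum S))
             (trans (signedSum-cong λ S → cong pow3 (η-unframed-true G x a enum S))
               (trans (signedSum-⊕ (λ S → pow3 (η (G₂ ⟨ lookup S ⟩))) (tabulate β))
                 (cong (λ m → -1ℤ ^ m ℤ.* ψSum G₂) ∣β∣))) ⟩
      ψSum G₃ ℤ.+ -1ℤ ℤ.* (-1ℤ ^ j ℤ.* ψSum G₂) ∎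

    rearrange : ∀ s z₁ z₂ z₃ → (z₃ ℤ.+ -1ℤ ℤ.* (s ℤ.* z₂)) ℤ.+ -1ℤ ℤ.* ((-1ℤ ℤ.* s) ℤ.* z₁) ≡
                (-1ℤ ℤ.* (-1ℤ ℤ.* s)) ℤ.* z₁ ℤ.+ (-1ℤ ℤ.* s) ℤ.* z₂ ℤ.+ + 1 ℤ.* z₃
    rearrange = solve-∀

theorem3p6 :
    ∀ {n j : ℕ} (let k = suc j) (G : Graph (suc (suc n))) (x : Fin (suc (suc n))) →
    degree G x ≡ k →
    (a : Vector (Fin (suc (suc n))) k) (enum : EnumeratesNeighbours G x a) →
    let a′ = neighboursAfterDelete G x a enum in
    ψ G ≡ ((-1ℤ ^ suc k) / 2) * ψ (invertedDelete G x)
          + ((-1ℤ ^ k) / 4) * ψ (spreadAndDelete (invertedDelete G x) a′)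
          + ((+ 1) / 4) * ψ (spreadAndDelete (delete G x) a′)
theorem3p6 {n} {j} G x deg a enum = trans
  -- `ψ G` is by definition `ψSum G` divided by a power of 2, so the integer recurrence only has to
  -- be distributed over the three denominators.
  (cong (λ z → (z / (2 ℕ.^ suc (suc n))) {{ℕ.m^n≢0 2 (suc (suc n))}}) (ψSum-recurrence G x deg a enum))
  (/-combine (-1ℤ ^ suc (suc j)) (-1ℤ ^ suc j) (ψSum (invertedDelete G x))
    (ψSum (spreadAndDelete (invertedDelete G x) a′)) (ψSum (spreadAndDelete (delete G x) a′)) (2 ℕ.^ n)
    {{ℕ.m^n≢0 2 n}} {{ℕ.m^n≢0 2 (suc n)}} {{ℕ.m^n≢0 2 (suc (suc n))}})
  where a′ = neighboursAfterDelete G x a enum
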